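{- For any finite simple graph $G$, the quotient of the separated deleted join $\widetilde Z(G)$ of the flag complex $\overline G$ by its free involution $\iota$ equals $Z(G)$. Consequently $\widetilde Z(G)$ is a double cover of $Z(G)$.
   Context: $\overline G$ is the flag (clique) complex of $G$. $\widetilde Z(G)$ is the simplicial complex on $V(G) \times \{ -1,+1\}$ whose faces are $(\sigma \times \{ -1\}) \cup (\rho \times \{+1\})$ for (possibly empty) cliques $\sigma,\rho$ of $G$ that are disjoint and have no edge of $G$ between them; $\iota$ swaps $(v,-1)$ and $(v,+1)$, and the quotient is the simplicial complex on $V(G)$ whose faces are the images of faces of $\widetilde Z(G)$. $Z(G)$ is the simplicial complex on $V(G)$ with complete 1-skeleton, in which a triangle is a face if and only if an odd number of its edges lie in $G$, and a simplex of dimension at least $2$ is a face if and only if all its triangles are faces. -}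

module Defs where

open import Data.Bool using (Bool; false; T; _∧_; _∨_; if_then_else_)
open import Data.Bool.Properties using (T-∧)
open import Data.Empty using (⊥-elim)
open import Data.Fin using (Fin; _≟_)
open import Data.Nat using (ℕ; _+_; _%_)
open import Data.Nat.Properties using (+-comm; +-assoc)
open import Data.Product using (_×_; _,_; ∃; ∃₂; proj₁; proj₂)
open import Data.Sign using (Sign; opposite) renaming (+ to ⊕; - to ⊖)
open import Data.Sum using (_⊎_; inj₁; inj₂)
open import Function.Base using (_∘_; id)
open import Function.Bundles using (_⇔_; mk⇔; Equivalence)
open import Level using (0ℓ)
open import Relation.Binary.Core using (Rel)
open import Relation.Binary.Definitions using (Decidable; Symmetric; Irreflexive)
open import Relation.Binary.PropositionalEquality using (_≡_; _≢_; refl; cong; trans)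
open import Relation.Nullary using (¬_; does; yes; no)
open import Relation.Nullary.Decidable using (does-⇔)

private
  variable
    X Y : Set

infix 4 _∈_ _⊆_ _≐_ _≋_

-- Subsets are only ever taken of the finite types V and V × Sign, so every
-- subset is a finite set and membership is decidable.
Subset : Set → Set
Subset X = X → Bool

_∈_ : X → Subset X → Set
x ∈ s = T (s x)

_⊆_ : Subset X → Subset X → Set
s ⊆ t = ∀ x → x ∈ s → x ∈ t

_≐_ : Subset X → Subset X → Set
s ≐ t = s ⊆ t × t ⊆ s

∅ : Subset X
∅ _ = false

Nonempty : Subset X → Set
Nonempty s = ∃ λ x → x ∈ s

Disjoint : Subset X → Subset X → Set
Disjoint s t = ∀ x → x ∈ s → ¬ x ∈ t

-- t = f(s)
IsImage : (X → Y) → Subset X → Subset Y → Set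
IsImage f s t = ∀ y → (y ∈ t) ⇔ (∃ λ x → x ∈ s × f x ≡ y)

InjectiveOn : (X → Y) → Subset X → Set
InjectiveOn f s = ∀ x x′ → x ∈ s → x′ ∈ s → f x ≡ f x′ → x ≡ x′

-- The empty set is a face of every complex.
record SimplicialComplex (X : Set) : Set₁ where
  field
    Face        : Subset X → Set
    ∅-face      : Face ∅
    down-closed : ∀ {s t} → s ⊆ t → Face t → Face s

open SimplicialComplex public

_≋_ : SimplicialComplex X → SimplicialComplex X → Set
K ≋ L = ∀ s → Face K s ⇔ Face L s

IsSimplicial : (X → Y) → SimplicialComplex X → SimplicialComplex Y → Set
IsSimplicial f K L = ∀ s t → Face K s → IsImage f s t → Face L t

-- A simplicial involution fixes a point of the geometric realization exactly
-- when it maps some nonempty face onto itself: the face whose interior contains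
-- a fixed point is invariant, and the barycentre of an invariant face is fixed.
record IsFreeInvolution (K : SimplicialComplex X) (f : X → X) : Set where
  field
    simplicial : IsSimplicial f K K
    involutive : ∀ x → f (f x) ≡ x
    free       : ∀ s → Face K s → Nonempty s → ¬ IsImage f s s

-- f restricts to an isomorphism from the full simplex on s onto that on t.
MapsIsomorphicallyOnto : (X → Y) → Subset X → Subset Y → Set
MapsIsomorphicallyOnto f s t = InjectiveOn f s × IsImage f s t

-- Two-sheeted simplicial covering: the preimage of every simplex t, i.e. the
-- subcomplex of all faces mapped into t, consists of two disjoint simplices,
-- each mapped isomorphically onto t.  (For t = ∅ the clause is trivial.)
record IsDoubleCover (f : X → Y) (K : SimplicialComplex X) (L : SimplicialComplex Y) : Set where
  field
    simplicial : IsSimplicial f K L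
    sheets     : ∀ t → Face L t → ∃₂ λ s₁ s₂ →
                   Face K s₁ × Face K s₂ ×
                   Disjoint s₁ s₂ ×
                   MapsIsomorphicallyOnto f s₁ t ×
                   MapsIsomorphicallyOnto f s₂ t ×
                   (∀ s → Face K s → (∀ x → x ∈ s → f x ∈ t) → s ⊆ s₁ ⊎ s ⊆ s₂)

imageComplex : (X → Y) → SimplicialComplex X → SimplicialComplex Y
imageComplex f K .Face t = ∃ λ s → Face K s × IsImage f s t
imageComplex f K .∅-face = ∅ , ∅-face K , λ y → mk⇔ (λ ()) (λ { (_ , () , _) })
imageComplex f K .down-closed {t′} {t} t′⊆t (s , s-face , im) =
  s′ , down-closed K (λ x → proj₁ ∘ Equivalence.to T-∧) s-face , λ y → mk⇔ (to y) (from y)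
  where
  s′ : Subset _
  s′ x = s x ∧ t′ (f x)

  to : ∀ y → y ∈ t′ → ∃ λ x → x ∈ s′ × f x ≡ y
  to y y∈t′ with Equivalence.to (im y) (t′⊆t y y∈t′)
  ... | x , x∈s , refl = x , Equivalence.from T-∧ (x∈s , y∈t′) , refl

  from : ∀ y → (∃ λ x → x ∈ s′ × f x ≡ y) → y ∈ t′
  from y (x , x∈s′ , refl) = proj₂ (Equivalence.to (T-∧ {s x}) x∈s′)

record FiniteSimpleGraph : Set₁ where
  field
    order  : ℕ
    Adj    : Rel (Fin order) 0ℓ
    adj?   : Decidable Adj
    sym    : Symmetric Adj
    irrefl : Irreflexive _≡_ Adj

  V : Set
  V = Fin order

module _ (G : FiniteSimpleGraph) where
  open FiniteSimpleGraph G renaming (sym to Adj-sym)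

  IsClique : Subset V → Set
  IsClique s = ∀ u v → u ∈ s → v ∈ s → u ≢ v → Adj u v

  flagComplex : SimplicialComplex V
  flagComplex .Face = IsClique
  flagComplex .∅-face u v ()
  flagComplex .down-closed s⊆t c u v u∈s v∈s = c u v (s⊆t u u∈s) (s⊆t v v∈s)

  Separated : Subset V → Subset V → Set
  Separated σ ρ = ∀ u v → u ∈ σ → v ∈ ρ → ¬ Adj u v

  -- (σ × {-1}) ∪ (ρ × {+1})
  _⋆_ : Subset V → Subset V → Subset (V × Sign)
  (σ ⋆ ρ) (v , ⊖) = σ v
  (σ ⋆ ρ) (v , ⊕) = ρ v

  Z̃ : SimplicialComplex (V × Sign)
  Z̃ .Face τ = ∃₂ λ σ ρ →
    Face flagComplex σ × Face flagComplex ρ × Disjoint σ ρ × Separated σ ρ × τ ≐ (σ ⋆ ρ)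
  Z̃ .∅-face =
    ∅ , ∅ , ∅-face flagComplex , ∅-face flagComplex , (λ _ ()) , (λ _ _ ()) ,
    (λ _ ()) , λ { (_ , ⊖) () ; (_ , ⊕) () }
  Z̃ .down-closed {τ′} {τ} τ′⊆τ (σ , ρ , σ-face , ρ-face , dis , sep , τ⊆ , _) =
    σ′ , ρ′ , down-closed flagComplex σ′⊆σ σ-face , down-closed flagComplex ρ′⊆ρ ρ-face ,
    (λ v v∈σ′ v∈ρ′ → dis v (σ′⊆σ v v∈σ′) (ρ′⊆ρ v v∈ρ′)) ,
    (λ u v u∈σ′ v∈ρ′ → sep u v (σ′⊆σ u u∈σ′) (ρ′⊆ρ v v∈ρ′)) ,
    (λ { (_ , ⊖) → id ; (_ , ⊕) → id }) , (λ { (_ , ⊖) → id ; (_ , ⊕) → id })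
    where
    σ′ ρ′ : Subset V
    σ′ v = τ′ (v , ⊖)
    ρ′ v = τ′ (v , ⊕)

    σ′⊆σ : σ′ ⊆ σ
    σ′⊆σ v v∈ = τ⊆ (v , ⊖) (τ′⊆τ (v , ⊖) v∈)

    ρ′⊆ρ : ρ′ ⊆ ρ
    ρ′⊆ρ v v∈ = τ⊆ (v , ⊕) (τ′⊆τ (v , ⊕) v∈)

  ι : V × Sign → V × Sign
  ι (v , ε) = v , opposite ε

  -- The vertex map of the quotient by ι; its fibres are the ι-orbits
  -- (see π-fibres), which identifies the set of orbits with V.
  π : V × Sign → V
  π = proj₁

  π-fibres : ∀ x y → (π x ≡ π y) ⇔ (y ≡ x ⊎ y ≡ ι x)
  π-fibres x y = mk⇔ (to x y) (from x y)
    where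
    to : ∀ x y → π x ≡ π y → y ≡ x ⊎ y ≡ ι x
    to (v , ⊖) (.v , ⊖) refl = inj₁ refl
    to (v , ⊖) (.v , ⊕) refl = inj₂ refl
    to (v , ⊕) (.v , ⊖) refl = inj₂ refl
    to (v , ⊕) (.v , ⊕) refl = inj₁ refl

    from : ∀ x y → y ≡ x ⊎ y ≡ ι x → π x ≡ π y
    from x .x     (inj₁ refl) = refl
    from x .(ι x) (inj₂ refl) = refl

  Z̃/ι : SimplicialComplex V
  Z̃/ι = imageComplex π Z̃

  edge : V → V → ℕ
  edge u v = if does (adj? u v) then 1 else 0

  edgeCount : V → V → V → ℕ
  edgeCount u v w = edge u v + edge v w + edge u w

  OddTriangle : V → V → V → Set
  OddTriangle u v w = edgeCount u v w % 2 ≡ 1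

  Distinct : V → V → V → Set
  Distinct u v w = u ≢ v × v ≢ w × u ≢ w

  -- Sets with at most two elements satisfy this vacuously.  That Z has the three
  -- properties which determine it is Z-complete-1-skeleton, Z-triangle and Z-flag.
  Z : SimplicialComplex V
  Z .Face s = ∀ u v w → u ∈ s → v ∈ s → w ∈ s → Distinct u v w → OddTriangle u v w
  Z .∅-face u v w ()
  Z .down-closed s⊆t odd u v w u∈s v∈s w∈s = odd u v w (s⊆t u u∈s) (s⊆t v v∈s) (s⊆t w w∈s)

  pair : V → V → Subset V
  pair u v x = does (x ≟ u) ∨ does (x ≟ v)

  triple : V → V → V → Subset V
  triple u v w x = does (x ≟ u) ∨ pair v w x

  private
    ∈-pair : ∀ {u v} x → x ∈ pair u v → x ≡ u ⊎ x ≡ v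
    ∈-pair {u} {v} x x∈ with x ≟ u | x ≟ v
    ... | yes p | _     = inj₁ p
    ... | no _  | yes q = inj₂ q

    data OneOf (u v w : V) : V → Set where
      1st : OneOf u v w u
      2nd : OneOf u v w v
      3rd : OneOf u v w w

    ∈-triple⁻ : ∀ {u v w} x → x ∈ triple u v w → OneOf u v w x
    ∈-triple⁻ {u} {v} {w} x x∈ with x ≟ u | x ≟ v | x ≟ w
    ... | yes refl | _        | _        = 1st
    ... | no _     | yes refl | _        = 2nd
    ... | no _     | no _     | yes refl = 3rd

    ∈-triple⁺ : ∀ {u v w x} → OneOf u v w x → x ∈ triple u v w
    ∈-triple⁺ {u} {v} {w} {x} o with x ≟ u | x ≟ v | x ≟ w
    ... | yes _ | _     | _     = _
    ... | no _  | yes _ | _     = _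
    ... | no _  | no _  | yes _ = _
    ∈-triple⁺ 1st | no p | no _ | no _ = p refl
    ∈-triple⁺ 2nd | no _ | no p | no _ = p refl
    ∈-triple⁺ 3rd | no _ | no _ | no p = p refl

    edge-sym : ∀ u v → edge u v ≡ edge v u
    edge-sym u v =
      cong (λ b → if b then 1 else 0) (does-⇔ (mk⇔ Adj-sym Adj-sym) (adj? u v) (adj? v u))

    rotate : ∀ u v w → OddTriangle u v w → OddTriangle v w u
    rotate u v w = trans (cong (_% 2) eq)
      where
      eq : edgeCount v w u ≡ edgeCount u v w
      eq rewrite edge-sym w u | edge-sym v u
               | +-comm (edge v w + edge u w) (edge u v)
               | +-assoc (edge u v) (edge v w) (edge u w) = refl

    swap : ∀ u v w → OddTriangle u v w → OddTriangle v u w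
    swap u v w = trans (cong (_% 2) eq)
      where
      eq : edgeCount v u w ≡ edgeCount u v w
      eq rewrite edge-sym v u
               | +-assoc (edge u v) (edge u w) (edge v w)
               | +-assoc (edge u v) (edge v w) (edge u w)
               | +-comm (edge u w) (edge v w) = refl

    odd-triple : ∀ {u v w x y z} → OddTriangle u v w →
      OneOf u v w x → OneOf u v w y → OneOf u v w z → Distinct x y z → OddTriangle x y z
    odd-triple o 1st 1st _   (p , _ , _) = ⊥-elim (p refl)
    odd-triple o 2nd 2nd _   (p , _ , _) = ⊥-elim (p refl)
    odd-triple o 3rd 3rd _   (p , _ , _) = ⊥-elim (p refl)
    odd-triple o _   1st 1st (_ , p , _) = ⊥-elim (p refl)
    odd-triple o _   2nd 2nd (_ , p , _) = ⊥-elim (p refl)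
    odd-triple o _   3rd 3rd (_ , p , _) = ⊥-elim (p refl)
    odd-triple o 1st _   1st (_ , _ , p) = ⊥-elim (p refl)
    odd-triple o 2nd _   2nd (_ , _ , p) = ⊥-elim (p refl)
    odd-triple o 3rd _   3rd (_ , _ , p) = ⊥-elim (p refl)
    odd-triple o 1st 2nd 3rd _ = o
    odd-triple o 2nd 3rd 1st _ = rotate _ _ _ o
    odd-triple o 3rd 1st 2nd _ = rotate _ _ _ (rotate _ _ _ o)
    odd-triple o 2nd 1st 3rd _ = swap _ _ _ o
    odd-triple o 1st 3rd 2nd _ = rotate _ _ _ (swap _ _ _ o)
    odd-triple o 3rd 2nd 1st _ = swap _ _ _ (rotate _ _ _ o)

  Z-complete-1-skeleton : ∀ u v → Face Z (pair u v)
  Z-complete-1-skeleton u v x y z x∈ y∈ z∈ (x≢y , y≢z , x≢z)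
    with ∈-pair x x∈ | ∈-pair y y∈ | ∈-pair z z∈
  ... | inj₁ refl | inj₁ refl | _         = ⊥-elim (x≢y refl)
  ... | inj₂ refl | inj₂ refl | _         = ⊥-elim (x≢y refl)
  ... | inj₁ refl | inj₂ _    | inj₁ refl = ⊥-elim (x≢z refl)
  ... | inj₁ _    | inj₂ refl | inj₂ refl = ⊥-elim (y≢z refl)
  ... | inj₂ _    | inj₁ refl | inj₁ refl = ⊥-elim (y≢z refl)
  ... | inj₂ refl | inj₁ _    | inj₂ refl = ⊥-elim (x≢z refl)

  Z-triangle : ∀ u v w → Distinct u v w → Face Z (triple u v w) ⇔ OddTriangle u v w
  Z-triangle u v w d = mk⇔
    (λ face → face u v w (∈-triple⁺ {u} {v} {w} 1st) (∈-triple⁺ {u} {v} {w} 2nd) (∈-triple⁺ {u} {v} {w} 3rd) d)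
    (λ o x y z x∈ y∈ z∈ → odd-triple o (∈-triple⁻ x x∈) (∈-triple⁻ y y∈) (∈-triple⁻ z z∈))

  Z-flag : ∀ s → Face Z s ⇔
    (∀ u v w → u ∈ s → v ∈ s → w ∈ s → Distinct u v w → Face Z (triple u v w))
  Z-flag s = mk⇔
    (λ face u v w u∈ v∈ w∈ d → Equivalence.from (Z-triangle u v w d) (face u v w u∈ v∈ w∈ d))
    (λ faces u v w u∈ v∈ w∈ d → Equivalence.to (Z-triangle u v w d) (faces u v w u∈ v∈ w∈ d))

{-# OPTIONS --safe #-}

-- Give a pair of vertices the sign + if they are equal or adjacent, and - otherwise.
-- A set of signed vertices is a face of Z̃ exactly when the sign of each pair is the
-- product of the two labels, and a set of vertices is a face of Z exactly when the sign
-- is a multiplicative cocycle on it (an odd number of edges in a triangle means an even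
-- number of non-edges).  A cocycle on a nonempty set is a coboundary: label each vertex
-- by its sign relative to a base point.  Such a labelling is unique up to a global sign,
-- and the two choices are the two sheets over the face.
module Submission where

open import Defs
open import Data.Bool using (true; false; if_then_else_)
open import Data.Fin using (_≟_)
open import Data.Fin.Properties using (any?)
open import Data.Product using (_×_; _,_; ∃; proj₁; proj₂)
open import Data.Sign using (Sign; opposite; _*_) renaming (+ to ⊕; - to ⊖)
open import Data.Sign.Properties using (*-assoc; *-cancelˡ-≡; *-identityʳ; opposite-involutive; s*s≡+; s≢opposite[s]) renaming (_≟_ to _≟ₛ_)
open import Data.Sum using (_⊎_; inj₁; inj₂; map; fromInj₂)
open import Function.Base using (_∘_)
open import Function.Bundles using (_⇔_; mk⇔; Equivalence)
open import Relation.Binary.PropositionalEquality using (_≡_; _≢_; refl; sym; trans; cong; cong₂; module ≡-Reasoning)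
open import Relation.Nullary using (¬_; Dec; does; yes; no; contradiction; _×-dec_; _⊎-dec_)
open import Relation.Nullary.Decidable using (T?; ⌊_⌋; toWitness; fromWitness; does-⇔; dec-true; dec-false)

open Equivalence using (to; from)

-- Arithmetic of signs

opposite-*-opposite : ∀ ε δ → opposite ε * opposite δ ≡ ε * δ
opposite-*-opposite ⊕ ⊕ = refl
opposite-*-opposite ⊕ ⊖ = refl
opposite-*-opposite ⊖ ⊕ = refl
opposite-*-opposite ⊖ ⊖ = refl

s*opposite[s]≡⊖ : ∀ ε → ε * opposite ε ≡ ⊖
s*opposite[s]≡⊖ ⊕ = refl
s*opposite[s]≡⊖ ⊖ = refl

≢⇒≡opposite : ∀ {ε δ} → ε ≢ δ → ε ≡ opposite δ
≢⇒≡opposite {⊕} {⊕} ε≢δ = contradiction refl ε≢δ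
≢⇒≡opposite {⊕} {⊖} _   = refl
≢⇒≡opposite {⊖} {⊕} _   = refl
≢⇒≡opposite {⊖} {⊖} ε≢δ = contradiction refl ε≢δ

-- The middle label occurs twice and squares to `⊕`. This is what makes the coboundary of a
-- labelling a cocycle.
*-telescope : ∀ ε δ η → (ε * δ) * (δ * η) ≡ ε * η
*-telescope ε δ η = begin
  (ε * δ) * (δ * η) ≡⟨ *-assoc ε δ (δ * η) ⟩
  ε * (δ * (δ * η)) ≡⟨ cong (ε *_) (*-assoc δ δ η) ⟨
  ε * ((δ * δ) * η) ≡⟨ cong (λ ζ → ε * (ζ * η)) (s*s≡+ δ) ⟩
  ε * η             ∎
  where open ≡-Reasoning

module _ (G : FiniteSimpleGraph) where
  open FiniteSimpleGraph G using (V; Adj; adj?) renaming (sym to Adj-sym)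

  -- The sign of a pair of vertices

  EqOrAdj : V → V → Set
  EqOrAdj u v = u ≡ v ⊎ Adj u v

  eqOrAdj? : ∀ u v → Dec (EqOrAdj u v)
  eqOrAdj? u v = u ≟ v ⊎-dec adj? u v

  -- The value `⊕` on the diagonal lets a single product rule express both disjointness and
  -- separation, and makes repeated vertices harmless in the cocycle equation.
  pairSign : V → V → Sign
  pairSign u v = if does (eqOrAdj? u v) then ⊕ else ⊖

  pairSign≡⊕⁺ : ∀ {u v} → EqOrAdj u v → pairSign u v ≡ ⊕
  pairSign≡⊕⁺ {u} {v} p = cong (if_then ⊕ else ⊖) (dec-true (eqOrAdj? u v) p)

  pairSign≡⊖⁺ : ∀ {u v} → ¬ EqOrAdj u v → pairSign u v ≡ ⊖
  pairSign≡⊖⁺ {u} {v} ¬p = cong (if_then ⊕ else ⊖) (dec-false (eqOrAdj? u v) ¬p)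

  pairSign≡⊕⁻ : ∀ {u v} → pairSign u v ≡ ⊕ → EqOrAdj u v
  pairSign≡⊕⁻ {u} {v} eq with eqOrAdj? u v
  ... | yes p = p
  ... | no ¬p = contradiction (trans (sym eq) (pairSign≡⊖⁺ ¬p)) λ ()

  pairSign≡⊖⁻ : ∀ {u v} → pairSign u v ≡ ⊖ → ¬ EqOrAdj u v
  pairSign≡⊖⁻ eq p = contradiction (trans (sym eq) (pairSign≡⊕⁺ p)) λ ()

  pairSign-refl : ∀ u → pairSign u u ≡ ⊕
  pairSign-refl u = pairSign≡⊕⁺ (inj₁ refl)

  pairSign-sym : ∀ u v → pairSign u v ≡ pairSign v u
  pairSign-sym u v = cong (if_then ⊕ else ⊖)
    (does-⇔ (mk⇔ (map sym Adj-sym) (map sym Adj-sym)) (eqOrAdj? u v) (eqOrAdj? v u))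

  pairSign-distinct : ∀ {u v} → u ≢ v → pairSign u v ≡ (if does (adj? u v) then ⊕ else ⊖)
  pairSign-distinct {u} {v} u≢v = cong (if_then ⊕ else ⊖)
    (does-⇔ (mk⇔ (fromInj₂ (λ u≡v → contradiction u≡v u≢v)) inj₂) (eqOrAdj? u v) (adj? u v))

  -- Faces of the deleted join as coherent sets

  Coherent : Subset (V × Sign) → Set
  Coherent τ = ∀ u v {ε δ} → (u , ε) ∈ τ → (v , δ) ∈ τ → pairSign u v ≡ ε * δ

  -- Equal labels have product `⊕`, which is the clique condition on either side of the join.
  -- Different labels have product `⊖`, which forbids both equality and adjacency across the two
  -- sides.
  Z̃-face⇔coherent : ∀ τ → Face (Z̃ G) τ ⇔ Coherent τ
  Z̃-face⇔coherent τ = mk⇔ coherent face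
    where
    coherent : Face (Z̃ G) τ → Coherent τ
    coherent (σ , ρ , σ-clique , ρ-clique , disjoint , separated , τ⊆ , _) u v {ε} {δ} u∈ v∈ =
      go ε δ (τ⊆ (u , ε) u∈) (τ⊆ (v , δ) v∈)
      where
      eqOrAdj : ∀ {κ} → IsClique G κ → u ∈ κ → v ∈ κ → EqOrAdj u v
      eqOrAdj clique u∈κ v∈κ with u ≟ v
      ... | yes u≡v = inj₁ u≡v
      ... | no  u≢v = inj₂ (clique u v u∈κ v∈κ u≢v)

      go : ∀ ε δ → (u , ε) ∈ _⋆_ G σ ρ → (v , δ) ∈ _⋆_ G σ ρ → pairSign u v ≡ ε * δ
      go ⊖ ⊖ u∈σ v∈σ = pairSign≡⊕⁺ (eqOrAdj σ-clique u∈σ v∈σ)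
      go ⊕ ⊕ u∈ρ v∈ρ = pairSign≡⊕⁺ (eqOrAdj ρ-clique u∈ρ v∈ρ)
      go ⊖ ⊕ u∈σ v∈ρ = pairSign≡⊖⁺ λ where
        (inj₁ refl) → disjoint u u∈σ v∈ρ
        (inj₂ u~v)  → separated u v u∈σ v∈ρ u~v
      go ⊕ ⊖ u∈ρ v∈σ = pairSign≡⊖⁺ λ where
        (inj₁ refl) → disjoint u v∈σ u∈ρ
        (inj₂ u~v)  → separated v u v∈σ u∈ρ (Adj-sym u~v)

    face : Coherent τ → Face (Z̃ G) τ
    face coh =
      (λ v → τ (v , ⊖)) , (λ v → τ (v , ⊕)) ,
      (λ u v u∈ v∈ u≢v → adjacent u≢v (coh u v u∈ v∈)) ,
      (λ u v u∈ v∈ u≢v → adjacent u≢v (coh u v u∈ v∈)) ,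
      (λ v v∈⊖ v∈⊕ → pairSign≡⊖⁻ (coh v v v∈⊖ v∈⊕) (inj₁ refl)) ,
      (λ u v u∈ v∈ u~v → pairSign≡⊖⁻ (coh u v u∈ v∈) (inj₂ u~v)) ,
      (λ { (_ , ⊖) x∈ → x∈ ; (_ , ⊕) x∈ → x∈ }) , (λ { (_ , ⊖) x∈ → x∈ ; (_ , ⊕) x∈ → x∈ })
      where
      adjacent : ∀ {u v} → u ≢ v → pairSign u v ≡ ⊕ → Adj u v
      adjacent u≢v = fromInj₂ (λ u≡v → contradiction u≡v u≢v) ∘ pairSign≡⊕⁻

  -- Faces of `Z` as cocycles

  Cocycle : Subset V → Set
  Cocycle t = ∀ u v w → u ∈ t → v ∈ t → w ∈ t → pairSign u v * pairSign v w ≡ pairSign u w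

  oddTriangle⇔cocycle : ∀ {u v w} → Distinct G u v w →
    OddTriangle G u v w ⇔ (pairSign u v * pairSign v w ≡ pairSign u w)
  oddTriangle⇔cocycle {u} {v} {w} (u≢v , v≢w , u≢w)
    -- Distinctness removes the equality disjunct from every sign, so both sides depend only on
    -- three booleans and each of the eight cases computes.
    rewrite pairSign-distinct u≢v | pairSign-distinct v≢w | pairSign-distinct u≢w
    with does (adj? u v) | does (adj? v w) | does (adj? u w)
  ... | true  | true  | true  = mk⇔ (λ _ → refl) (λ _ → refl)
  ... | true  | true  | false = mk⇔ (λ ()) (λ ())
  ... | true  | false | true  = mk⇔ (λ ()) (λ ())
  ... | true  | false | false = mk⇔ (λ _ → refl) (λ _ → refl)
  ... | false | true  | true  = mk⇔ (λ ()) (λ ())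
  ... | false | true  | false = mk⇔ (λ _ → refl) (λ _ → refl)
  ... | false | false | true  = mk⇔ (λ _ → refl) (λ _ → refl)
  ... | false | false | false = mk⇔ (λ ()) (λ ())

  -- Faces of `Z` constrain distinct triples only. A triple with a repetition satisfies the cocycle
  -- equation anyway, since `pairSign` is symmetric and is `⊕` on the diagonal.
  Z-face⇔cocycle : ∀ t → Face (Z G) t ⇔ Cocycle t
  Z-face⇔cocycle t = mk⇔ cocycle
    (λ coc u v w u∈ v∈ w∈ d → from (oddTriangle⇔cocycle d) (coc u v w u∈ v∈ w∈))
    where
    cocycle : Face (Z G) t → Cocycle t
    cocycle odd u v w u∈ v∈ w∈ = go (u ≟ v) (v ≟ w) (u ≟ w)
      where
      open ≡-Reasoning

      go : Dec (u ≡ v) → Dec (v ≡ w) → Dec (u ≡ w) → pairSign u v * pairSign v w ≡ pairSign u w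
      go (yes refl) _          _          = cong (_* pairSign u w) (pairSign-refl u)
      go _          (yes refl) _          =
        trans (cong (pairSign u v *_) (pairSign-refl v)) (*-identityʳ (pairSign u v))
      go _          _          (yes refl) = begin
        pairSign u v * pairSign v u ≡⟨ cong (pairSign u v *_) (pairSign-sym v u) ⟩
        pairSign u v * pairSign u v ≡⟨ s*s≡+ (pairSign u v) ⟩
        ⊕                           ≡⟨ pairSign-refl u ⟨
        pairSign u u                ∎
      go (no u≢v)   (no v≢w)   (no u≢w)   =
        let d = u≢v , v≢w , u≢w in to (oddTriangle⇔cocycle d) (odd u v w u∈ v∈ w∈ d)

  -- Balanced labellings: cocycles as coboundaries

  Balances : (V → Sign) → Subset V → Set
  Balances ℓ t = ∀ u v → u ∈ t → v ∈ t → pairSign u v ≡ ℓ u * ℓ v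

  cocycle⇒balanced : ∀ {t} → Cocycle t → ∃ λ ℓ → Balances ℓ t
  cocycle⇒balanced {t} coc with any? (λ v → T? (t v))
  -- Without a base point the condition is vacuous, and the constant label is an arbitrary choice.
  ... | no  t-empty  = (λ _ → ⊕) , λ u _ u∈ _ → contradiction (u , u∈) t-empty
  -- The cocycle equation is used with the base point `a` as middle vertex.
  ... | yes (a , a∈) = pairSign a , λ u v u∈ v∈ →
    trans (sym (coc u a v u∈ a∈ v∈)) (cong (_* pairSign a v) (pairSign-sym u a))

  balances-opposite : ∀ ℓ {t} → Balances ℓ t → Balances (opposite ∘ ℓ) t
  balances-opposite ℓ bal u v u∈ v∈ =
    trans (bal u v u∈ v∈) (sym (opposite-*-opposite (ℓ u) (ℓ v)))

  -- The two sheets over a face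

  inSheet? : ∀ (ℓ : V → Sign) (t : Subset V) ((v , ε) : V × Sign) → Dec (v ∈ t × ε ≡ ℓ v)
  inSheet? ℓ t (v , ε) = T? (t v) ×-dec ε ≟ₛ ℓ v

  -- The graph of `ℓ` restricted to `t`; balance of `ℓ` on `t` is coherence of this graph.
  sheet : (V → Sign) → Subset V → Subset (V × Sign)
  sheet ℓ t x = ⌊ inSheet? ℓ t x ⌋

  ∈-sheet⁺ : ∀ ℓ t {v ε} → v ∈ t → ε ≡ ℓ v → (v , ε) ∈ sheet ℓ t
  ∈-sheet⁺ ℓ t v∈ ε≡ = fromWitness {a? = inSheet? ℓ t _} (v∈ , ε≡)

  ∈-sheet⁻ : ∀ ℓ t {v ε} → (v , ε) ∈ sheet ℓ t → v ∈ t × ε ≡ ℓ v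
  ∈-sheet⁻ ℓ t x∈ = toWitness {a? = inSheet? ℓ t _} x∈

  sheet-face : ∀ ℓ {t} → Balances ℓ t → Face (Z̃ G) (sheet ℓ t)
  sheet-face ℓ {t} bal = from (Z̃-face⇔coherent _) coherent
    where
    coherent : Coherent (sheet ℓ t)
    coherent u v x∈ y∈ with ∈-sheet⁻ ℓ t x∈ | ∈-sheet⁻ ℓ t y∈
    ... | u∈ , refl | v∈ , refl = bal u v u∈ v∈

  sheet-isImage : ∀ ℓ t → IsImage (π G) (sheet ℓ t) t
  sheet-isImage ℓ t v = mk⇔
    (λ v∈ → (v , ℓ v) , ∈-sheet⁺ ℓ t v∈ refl , refl)
    (λ { (_ , x∈ , refl) → proj₁ (∈-sheet⁻ ℓ t x∈) })

  sheet-injectiveOn : ∀ ℓ t → InjectiveOn (π G) (sheet ℓ t)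
  sheet-injectiveOn ℓ t (v , _) (.v , _) x∈ y∈ refl =
    cong (v ,_) (trans (proj₂ (∈-sheet⁻ ℓ t x∈)) (sym (proj₂ (∈-sheet⁻ ℓ t y∈))))

  sheets-disjoint : ∀ ℓ t → Disjoint (sheet ℓ t) (sheet (opposite ∘ ℓ) t)
  sheets-disjoint ℓ t (v , ε) x∈₁ x∈₂ = s≢opposite[s] (ℓ v)
    (trans (sym (proj₂ (∈-sheet⁻ ℓ t x∈₁))) (proj₂ (∈-sheet⁻ (opposite ∘ ℓ) t x∈₂)))

  -- If the face agrees with `ℓ` at one vertex `u`, coherence and balance compute the same sign for
  -- `u` and any other vertex, and cancelling `ℓ u` forces agreement everywhere. Otherwise it
  -- disagrees everywhere, so its labels are the opposite ones.
  face-over⇒in-sheet : ∀ ℓ {t} → Balances ℓ t → ∀ s → Face (Z̃ G) s →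
    (∀ x → x ∈ s → π G x ∈ t) → s ⊆ sheet ℓ t ⊎ s ⊆ sheet (opposite ∘ ℓ) t
  face-over⇒in-sheet ℓ {t} bal s s-face over with any? (λ v → T? (s (v , ℓ v)))
  ... | yes (u , u∈) = inj₁ λ (v , ε) x∈ →
    ∈-sheet⁺ ℓ t (over _ x∈) (*-cancelˡ-≡ (ℓ u) ε (ℓ v)
      (trans (sym (to (Z̃-face⇔coherent s) s-face u v u∈ x∈)) (bal u v (over _ u∈) (over _ x∈))))
  ... | no none = inj₂ λ (v , ε) x∈ →
    ∈-sheet⁺ (opposite ∘ ℓ) t (over _ x∈)
      (≢⇒≡opposite λ { refl → none (v , x∈) })

  -- The involution, the quotient and the covering

  ι-isFreeInvolution : IsFreeInvolution (Z̃ G) (ι G)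
  ι-isFreeInvolution = record
    { simplicial = λ s t s-face im →
        from (Z̃-face⇔coherent t) (ι-coherent (to (Z̃-face⇔coherent s) s-face) im)
    ; involutive = λ (v , ε) → cong (v ,_) (opposite-involutive ε)
    -- An invariant face would contain both lifts of `v`, whose labels have product `⊖`, although
    -- the pair `v`, `v` has sign `⊕`.
    ; free = λ { s s-face (x@(v , ε) , x∈) im → pairSign≡⊖⁻
        (trans (to (Z̃-face⇔coherent s) s-face v v x∈ (from (im (ι G x)) (x , x∈ , refl)))
               (s*opposite[s]≡⊖ ε))
        (inj₁ refl) }
    }
    where
    ι-coherent : ∀ {s t} → Coherent s → IsImage (ι G) s t → Coherent t
    ι-coherent coh im u v x∈ y∈ with to (im _) x∈ | to (im _) y∈
    ... | (_ , ε) , x′∈ , refl | (_ , δ) , y′∈ , refl =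
      trans (coh u v x′∈ y′∈) (sym (opposite-*-opposite ε δ))

  Z̃/ι≋Z : Z̃/ι G ≋ Z G
  Z̃/ι≋Z t = mk⇔ project lift
    where
    project : Face (Z̃/ι G) t → Face (Z G) t
    project (s , s-face , im) = from (Z-face⇔cocycle t) cocycle
      where
      coh : Coherent s
      coh = to (Z̃-face⇔coherent s) s-face

      cocycle : Cocycle t
      cocycle u v w u∈ v∈ w∈ with to (im u) u∈ | to (im v) v∈ | to (im w) w∈
      -- Any lifts of the three vertices will do: coherence turns each sign into a product of their
      -- labels.
      ... | (_ , ε) , x∈ , refl | (_ , δ) , y∈ , refl | (_ , η) , z∈ , refl = begin
        pairSign u v * pairSign v w ≡⟨ cong₂ _*_ (coh u v x∈ y∈) (coh v w y∈ z∈) ⟩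
        (ε * δ) * (δ * η)           ≡⟨ *-telescope ε δ η ⟩
        ε * η                       ≡⟨ coh u w x∈ z∈ ⟨
        pairSign u w                ∎
        where open ≡-Reasoning

    lift : Face (Z G) t → Face (Z̃/ι G) t
    lift t-face with cocycle⇒balanced (to (Z-face⇔cocycle t) t-face)
    ... | ℓ , bal = sheet ℓ t , sheet-face ℓ bal , sheet-isImage ℓ t

  π-isDoubleCover : IsDoubleCover (π G) (Z̃ G) (Z G)
  π-isDoubleCover = record
    { simplicial = λ s t s-face im → to (Z̃/ι≋Z t) (s , s-face , im)
    ; sheets = λ t t-face →
        let ℓ , bal = cocycle⇒balanced (to (Z-face⇔cocycle t) t-face)
        in sheet ℓ t , sheet (opposite ∘ ℓ) t ,
           sheet-face ℓ bal , sheet-face (opposite ∘ ℓ) (balances-opposite ℓ bal) ,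
           sheets-disjoint ℓ t ,
           (sheet-injectiveOn ℓ t , sheet-isImage ℓ t) ,
           (sheet-injectiveOn (opposite ∘ ℓ) t , sheet-isImage (opposite ∘ ℓ) t) ,
           face-over⇒in-sheet ℓ bal
    }

theorem3p3 : (G : FiniteSimpleGraph) → IsFreeInvolution (Z̃ G) (ι G) × (Z̃/ι G ≋ Z G) × IsDoubleCover (π G) (Z̃ G) (Z G)
theorem3p3 G = ι-isFreeInvolution G , Z̃/ι≋Z G , π-isDoubleCover G
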